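{- $\mathrm{coWMPL}<\mathrm{coWMTL}<\mathrm{coWMSO}$, both over the class of all Kripke trees and over the class of finitely-branching Kripke trees.
   Context: Trees. A tree $T$ is a subset of $\mathbb{N}^*$ (finite words over the naturals) with an element $\tau_0\in T$ (the root) such that every $\tau\in T$ has the form $\tau_0\cdot\tau'$ with $\tau'\in\mathbb{N}^*$, and whenever $\tau_0\cdot\tau\in T$ and $\tau'$ is a prefix of $\tau$, also $\tau_0\cdot\tau'\in T$. Elements of $T$ are nodes. A child of $\tau$ in $T$ is a node of $T$ of the form $\tau\cdot n$, $n\in\mathbb{N}$; a descendant of $\tau$ in $T$ is a node of $T$ of the form $\tau\cdot\tau'$, $\tau'\in\mathbb{N}^*$ (so $\tau$ is a descendant of itself). A subtree of $T$ is a subset of $T$ that is a tree (with any root). A path of $T$ is a subtree of $T$ each of whose nodes has at most one child in it. $T$ is non-blocking if every node has a child in $T$, and finitely-branching if every node has finitely many children in $T$. For a finite set $AP$ of atomic propositions, a Kripke tree over $AP$ is a pair $(T,\mathrm{Lab})$ with $T$ a non-blocking tree and $\mathrm{Lab}:T\to 2^{AP}$; it is finitely-branching if $T$ is. Logics. Formulas over $AP$ are generated by $\varphi ::= P_a(x)\mid x\le y\mid x\in X\mid \neg\varphi\mid\varphi\wedge\varphi\mid\exists x.\varphi\mid\exists^{\alpha}X.\varphi$, with $a\in AP$, $x,y$ first-order variables, $X$ second-order variables. Over $(T,\mathrm{Lab})$, first-order variables range over nodes of $T$; $P_a(x)$ holds iff $a\in\mathrm{Lab}(x)$; $x\le y$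 holds iff $y$ is a descendant of $x$ in $T$; $x\in X$ is membership; Boolean connectives and $\exists x$ are standard. The range of second-order quantification determines the logic: in coWMSO (co-weak monadic second-order logic) it ranges over the infinite subsets of $T$; in coWMTL (co-weak monadic tree logic) over the infinite subtrees of $T$; in coWMPL (co-weak monadic path logic) over the infinite paths of $T$. A logic consists of its sentences (formulas without free variables). Expressiveness. Over a class of Kripke trees, two sentences over the same $AP$ are equivalent if they are satisfied by the same members (over $AP$) of the class. $L\le L'$ means that, for every finite $AP$, each $L$-sentence over $AP$ has an equivalent $L'$-sentence over $AP$. $L<L'$ means $L\le L'$ and $L'\not\le L$. -}

module Defs where

open import Data.Fin using (Fin)
open import Data.Fin.Subset using (Subset) renaming (_∈_ to _∈ₛ_)
open import Data.List using (List; _++_; _∷ʳ_)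
import Data.List.Membership.Propositional as List
open import Data.List.Relation.Binary.Prefix.Heterogeneous using (Prefix)
open import Data.Nat using (ℕ; suc)
open import Data.Product using (∃; ∃-syntax; _×_; proj₁; proj₂)
open import Data.Vec.Functional using (Vector; []; _∷_)
open import Function using (_⇔_)
open import Level using (Lift; 0ℓ) renaming (suc to lsuc)
open import Relation.Binary.PropositionalEquality using (_≡_)
open import Relation.Nullary using (¬_)
open import Relation.Unary using (Pred; U; _∈_; _⊆_)

Word : Set
Word = List ℕ

WordSet : Set₁
WordSet = Pred Word 0ℓ

Finite : WordSet → Set
Finite X = ∃[ ws ] (∀ w → w ∈ X → w List.∈ ws)

Infinite : WordSet → Set
Infinite X = ¬ Finite X

record IsTree (T : WordSet) : Set where
  field
    root          : Word
    root∈         : root ∈ T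
    below-root    : ∀ {τ} → τ ∈ T → ∃[ τ′ ] τ ≡ root ++ τ′
    prefix-closed : ∀ {τ τ′} → root ++ τ ∈ T → Prefix _≡_ τ′ τ → root ++ τ′ ∈ T

-- σ ∈ Children T τ: σ is a child of τ in T.
Children : WordSet → Word → WordSet
Children T τ σ = σ ∈ T × ∃[ n ] σ ≡ τ ∷ʳ n

NonBlocking : WordSet → Set
NonBlocking T = ∀ {τ} → τ ∈ T → ∃[ σ ] σ ∈ Children T τ

IsSubtree : WordSet → WordSet → Set
IsSubtree T X = X ⊆ T × IsTree X

IsPath : WordSet → WordSet → Set
IsPath T X = IsSubtree T X ×
  (∀ {τ σ σ′} → τ ∈ X → σ ∈ Children X τ → σ′ ∈ Children X τ → σ ≡ σ′)

-- A finite set of atomic propositions is represented by Fin n.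
-- The labelling is irrelevant in the membership proof, so that it is a
-- function of the node alone.
record KripkeTree (n : ℕ) : Set₁ where
  field
    T           : WordSet
    isTree      : IsTree T
    nonBlocking : NonBlocking T
    Lab         : ∀ τ → .(τ ∈ T) → Subset n

  Node : Set
  Node = ∃[ τ ] τ ∈ T

open KripkeTree using (T; Lab; Node)

Class : Set₁
Class = ∀ {n} → KripkeTree n → Set

AllTrees : Class
AllTrees K = U K

FinitelyBranching : Class
FinitelyBranching K = ∀ {τ} → τ ∈ T K → Finite (Children (T K) τ)

data Logic : Set where
  coWMSO coWMTL coWMPL : Logic

Range : Logic → WordSet → Pred WordSet 0ℓ
Range coWMSO T X = X ⊆ T × Infinite X
Range coWMTL T X = IsSubtree T X × Infinite X
Range coWMPL T X = IsPath T X × Infinite X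

infix  9 _≤′_ _∈′_
infixr 8 ¬′_ ∃₁_ ∃₂_
infixr 7 _∧′_

-- Formula L n i j: formulas of L over n atomic propositions, with free
-- first-order variables in Fin i and free second-order variables in Fin j
-- (de Bruijn indices: a quantifier binds index zero of its body).
data Formula (L : Logic) (n : ℕ) : ℕ → ℕ → Set where
  P    : ∀ {i j} → Fin n → Fin i → Formula L n i j
  _≤′_ : ∀ {i j} → Fin i → Fin i → Formula L n i j
  _∈′_ : ∀ {i j} → Fin i → Fin j → Formula L n i j
  ¬′_  : ∀ {i j} → Formula L n i j → Formula L n i j
  _∧′_ : ∀ {i j} → Formula L n i j → Formula L n i j → Formula L n i j
  ∃₁_  : ∀ {i j} → Formula L n (suc i) j → Formula L n i j
  ∃₂_  : ∀ {i j} → Formula L n i (suc j) → Formula L n i j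

Sentence : Logic → ℕ → Set
Sentence L n = Formula L n 0 0

Sat : ∀ {L n i j} (K : KripkeTree n) →
      Vector (Node K) i → Vector WordSet j → Formula L n i j → Set₁
Sat K ρ θ (P a x)       = Lift (lsuc 0ℓ) (a ∈ₛ Lab K (proj₁ (ρ x)) (proj₂ (ρ x)))
Sat K ρ θ (x ≤′ y)      = Lift (lsuc 0ℓ) (∃[ τ′ ] proj₁ (ρ y) ≡ proj₁ (ρ x) ++ τ′)
Sat K ρ θ (x ∈′ X)      = Lift (lsuc 0ℓ) (proj₁ (ρ x) ∈ θ X)
Sat K ρ θ (¬′ φ)        = ¬ Sat K ρ θ φ
Sat K ρ θ (φ ∧′ ψ)      = Sat K ρ θ φ × Sat K ρ θ ψ
Sat K ρ θ (∃₁ φ)        = ∃[ v ] Sat K (v ∷ ρ) θ φ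
Sat {L} K ρ θ (∃₂ φ)    = ∃[ X ] Range L (T K) X × Sat K ρ (X ∷ θ) φ

infix 4 _⊨_

_⊨_ : ∀ {L n} → KripkeTree n → Sentence L n → Set₁
K ⊨ φ = Sat K [] [] φ

Equivalent : Class → ∀ {L L′ n} → Sentence L n → Sentence L′ n → Set₁
Equivalent C {n = n} φ ψ = (K : KripkeTree n) → C K → K ⊨ φ ⇔ K ⊨ ψ

infix 4 _≤[_]_ _<[_]_

_≤[_]_ : Logic → Class → Logic → Set₁
L ≤[ C ] L′ = ∀ n (φ : Sentence L n) → ∃[ ψ ] Equivalent C {L} {L′} φ ψ

_<[_]_ : Logic → Class → Logic → Set₁
L <[ C ] L′ = L ≤[ C ] L′ × ¬ (L′ ≤[ C ] L)

{-# OPTIONS --safe #-}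
module Submission where

-- Paths are the linearly ordered subtrees and subtrees are the rooted convex
-- sets, which gives the two inclusions by guarding the set quantifiers.
--
-- Both separations use "the spine position m is even" on combs, whose nodes
-- are the words 0^x 1^y (node y of the tooth at spine position x), with m
-- marked.  Parity needs sets of spine positions: infinite sets provide them on
-- a bare spine, subtrees on a comb with teeth (by which teeth they enter).  But
-- an infinite path of a comb is fixed by its root and its end, and so is an
-- infinite subtree of a bare spine, so that coWMPL on the comb and coWMTL on
-- the spine are first-order.  A first-order formula does not notice a new spine
-- point inserted into a gap that is free of the points named so far and long
-- compared to the quantifier depth: a further point leaves one half of
-- the gap free, and inserting the new point there gives the same structure.

open import Defs
open import Axiom.ExcludedMiddle using (ExcludedMiddle)
open import Data.Bool using (Bool; true; false)
open import Data.Empty using (⊥)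
open import Data.Fin using (Fin; zero; suc)
open import Data.Fin.Subset using (Subset) renaming (_∈_ to _∈ₛ_)
open import Data.List using (List; []; _∷_; _++_; _∷ʳ_; [_]; length; replicate; map; upTo;
  cartesianProduct; initLast; _∷ʳ′_)
open import Data.List.Membership.Propositional.Properties using (∈-map⁺; ∈-cartesianProduct⁺; ∈-upTo⁺)
open import Data.List.Properties
import Data.List.Membership.Propositional as List
open import Data.List.Relation.Unary.Any using (here; there)
open import Data.List.Relation.Binary.Prefix.Heterogeneous using (Prefix; []; _∷_)
open import Data.Maybe using (Maybe; just; nothing)
open import Data.Maybe.Relation.Binary.Pointwise using (Pointwise; just; nothing)
open import Data.Nat hiding (_≤′_)
open import Data.Nat.Properties
open import Data.Product using (Σ; ∃; ∃-syntax; _×_; _,_; proj₁; proj₂; map₂)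
open import Data.Product.Function.NonDependent.Propositional using (_×-⇔_)
open import Data.Sum using (_⊎_; inj₁; inj₂; [_,_]′)
open import Data.Sum.Function.Propositional using (_⊎-⇔_)
open import Data.Unit using (⊤; tt)
import Data.Vec as Vec
open import Data.Vec.Functional using (Vector) renaming ([] to []ᵥ; _∷_ to infixr 5 _∷ᵥ_)
open import Data.Vec.Properties using (lookup⇒[]=; []=⇒lookup)
open import Function using (_⇔_; mk⇔; _∘_; Equivalence)
open import Function.Properties.Equivalence using () renaming (refl to ⇔-refl; sym to ⇔-sym; trans to ⇔-trans)
open import Function.Related.TypeIsomorphisms using (¬-cong-⇔)
open import Level using (Lift; lift; lower; 0ℓ) renaming (suc to lsuc)
open import Relation.Binary.PropositionalEquality using (_≡_; refl; sym; trans; cong; cong₂; subst; subst₂;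
  module ≡-Reasoning)
open import Relation.Nullary using (¬_; Dec; yes; no; does; contradiction)
open import Relation.Nullary.Decidable using (decidable-stable)
open import Relation.Unary using (_∈_; _⊆_)

open KripkeTree
open Equivalence using (to; from)

-- The prefix order on words.

infix 4 _⊑_

_⊑_ : Word → Word → Set
u ⊑ w = ∃[ v ] w ≡ u ++ v

⊑-refl : ∀ {u} → u ⊑ u
⊑-refl = [] , sym (++-identityʳ _)

⊑-trans : ∀ {u v w} → u ⊑ v → v ⊑ w → u ⊑ w
⊑-trans (a , refl) (b , refl) = a ++ b , ++-assoc _ a b

⊑-length : ∀ {u w} → u ⊑ w → length u ≤ length w
⊑-length {u} (v , refl) = subst (length u ≤_) (sym (length-++ u)) (m≤m+n _ _)

⊑-length-≡ : ∀ {u w} → u ⊑ w → length w ≤ length u → u ≡ w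
⊑-length-≡ {u} ([]    , refl) _ = sym (++-identityʳ u)
⊑-length-≡ {u} (a ∷ v , refl) q = contradiction
  (≤-trans (+-monoʳ-< (length u) z<s) (subst (_≤ length u) (length-++ u) q)) (<-irrefl (+-identityʳ _))

length-∷ʳ : ∀ (u : Word) n → length (u ∷ʳ n) ≡ suc (length u)
length-∷ʳ u n = trans (length-++ u) (+-comm _ 1)

⊑-∷ʳ : ∀ {u w n} → u ⊑ w ∷ʳ n → u ⊑ w ⊎ u ≡ w ∷ʳ n
⊑-∷ʳ {u} (v , eq) with initLast v
... | []       = inj₂ (trans (sym (++-identityʳ u)) (sym eq))
... | v′ ∷ʳ′ m = inj₁ (v′ , ∷ʳ-injectiveˡ _ _ (trans eq (sym (++-assoc u v′ [ m ]))))

Prefix⇒⊑ : ∀ {u w : Word} → Prefix _≡_ u w → u ⊑ w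
Prefix⇒⊑ []         = _ , refl
Prefix⇒⊑ (refl ∷ p) with v , refl ← Prefix⇒⊑ p = v , refl

⊑⇒Prefix : ∀ (u : Word) {v} → Prefix _≡_ u (u ++ v)
⊑⇒Prefix []      = []
⊑⇒Prefix (a ∷ u) = refl ∷ ⊑⇒Prefix u

⊑-++⁻ : ∀ r {u w} → r ++ u ⊑ r ++ w → u ⊑ w
⊑-++⁻ r {u} (v , eq) = v , ++-cancelˡ r _ _ (trans eq (++-assoc r u v))

⊑-++⁺ : ∀ r {u w} → u ⊑ w → r ++ u ⊑ r ++ w
⊑-++⁺ r {u} (v , refl) = v , sym (++-assoc r u v)

-- Trees and paths in terms of the prefix order.

RootedConvex : WordSet → Set
RootedConvex X = ∃[ r ] r ∈ X × (∀ {w} → w ∈ X → r ⊑ w) ×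
  (∀ {u w} → w ∈ X → r ⊑ u → u ⊑ w → u ∈ X)

IsTree⇔RootedConvex : ∀ {X} → IsTree X ⇔ RootedConvex X
IsTree⇔RootedConvex {X} = mk⇔ f g
  where
  f : IsTree X → RootedConvex X
  f t = root , root∈ , below-root , convex
    where
    open IsTree t
    convex : ∀ {u w} → w ∈ X → root ⊑ u → u ⊑ w → u ∈ X
    convex w∈ (a , refl) u⊑w with b , refl ← below-root w∈
      with c , refl ← ⊑-++⁻ root u⊑w =
      prefix-closed w∈ (⊑⇒Prefix a)
  g : RootedConvex X → IsTree X
  g (r , r∈ , below , convex) = record
    { root          = r
    ; root∈         = r∈
    ; below-root    = below
    ; prefix-closed = λ w∈ p → convex w∈ (_ , refl) (⊑-++⁺ r (Prefix⇒⊑ p))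
    }

tree-convex : ∀ {T} → IsTree T → ∀ {r u w} → r ∈ T → w ∈ T → r ⊑ u → u ⊑ w → u ∈ T
tree-convex t r∈ w∈ r⊑u u⊑w with _ , _ , below , convex ← to IsTree⇔RootedConvex t =
  convex w∈ (⊑-trans (below r∈) r⊑u) u⊑w

Chain : WordSet → Set
Chain X = ∀ {u w} → u ∈ X → w ∈ X → u ⊑ w ⊎ w ⊑ u

UniqueChildren : WordSet → Set
UniqueChildren X = ∀ {τ σ σ′} → τ ∈ X → σ ∈ Children X τ → σ′ ∈ Children X τ → σ ≡ σ′

chain⇒uniqueChildren : ∀ {X} → Chain X → UniqueChildren X
chain⇒uniqueChildren chain {τ} _ (σ∈ , m , refl) (σ′∈ , n , refl) with chain σ∈ σ′∈
... | inj₁ p = ⊑-length-≡ p (≤-reflexive (trans (length-∷ʳ τ n) (sym (length-∷ʳ τ m))))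
... | inj₂ p = sym (⊑-length-≡ p (≤-reflexive (trans (length-∷ʳ τ m) (sym (length-∷ʳ τ n)))))

-- From the root downwards, as long as neither word has ended, the next letters give two children in
-- `X` of one node, so they agree; once one word ends, it is a prefix of the other.
uniqueChildren⇒chain : ∀ {X} → IsTree X → UniqueChildren X → Chain X
uniqueChildren⇒chain {X} t unique u∈ w∈
  with a , refl ← IsTree.below-root t u∈ | b , refl ← IsTree.below-root t w∈ =
  go a b (IsTree.root∈ t) u∈ w∈
  where
  child : ∀ {c} → c ∈ X → ∀ m a → c ++ m ∷ a ∈ X → c ∷ʳ m ∈ Children X c
  child {c} c∈ m a p = tree-convex t c∈ p (_ , refl) (a , sym (∷ʳ-++ c m a)) , m , refl
  go : ∀ a b {c} → c ∈ X → c ++ a ∈ X → c ++ b ∈ X → c ++ a ⊑ c ++ b ⊎ c ++ b ⊑ c ++ a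
  go []      b       {c} _  _  _  = inj₁ (⊑-++⁺ c (b , refl))
  go (m ∷ a) []      {c} _  _  _  = inj₂ (⊑-++⁺ c (m ∷ a , refl))
  go (m ∷ a) (n ∷ b) {c} c∈ u∈ w∈
    with eq ← unique c∈ (child c∈ m a u∈) (child c∈ n b w∈)
    with refl ← ∷ʳ-injectiveʳ c c eq =
    subst₂ (λ u w → u ⊑ w ⊎ w ⊑ u) (∷ʳ-++ c m a) (∷ʳ-++ c m b)
      (go a b (proj₁ (child c∈ m a u∈)) (subst X (sym (∷ʳ-++ c m a)) u∈) (subst X (sym (∷ʳ-++ c m b)) w∈))

IsPath⇔Chain : ∀ {T X} → IsPath T X ⇔ (IsSubtree T X × Chain X)
IsPath⇔Chain = mk⇔
  (λ (s , unique) → s , uniqueChildren⇒chain (proj₂ s) unique)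
  (λ (s , chain) → s , chain⇒uniqueChildren chain)

-- Guarded set quantifiers.

pattern v0 = zero
pattern v1 = suc zero
pattern v2 = suc (suc zero)

∃-cong : ∀ {a b c} {A : Set a} {B : A → Set b} {C : A → Set c} →
         (∀ x → B x ⇔ C x) → ∃ B ⇔ ∃ C
∃-cong h = mk⇔ (map₂ (to (h _))) (map₂ (from (h _)))

lift-⇔ : ∀ {a b ℓ} {A : Set a} {B : Set b} → A ⇔ B → Lift ℓ A ⇔ B
lift-⇔ h = mk⇔ (to h ∘ lower) (lift ∘ from h)

translate : ∀ {L L′ n} → (∀ {i j} → Formula L′ n i (suc j)) →
            ∀ {i j} → Formula L n i j → Formula L′ n i j
translate g (P a x)  = P a x
translate g (x ≤′ y) = x ≤′ y
translate g (x ∈′ X) = x ∈′ X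
translate g (¬′ φ)   = ¬′ translate g φ
translate g (φ ∧′ ψ) = translate g φ ∧′ translate g ψ
translate g (∃₁ φ)   = ∃₁ translate g φ
translate g (∃₂ φ)   = ∃₂ (g ∧′ translate g φ)

-- Since `ρ` and `θ` are arbitrary, the guard speaks only of the set just bound and can stand under
-- any quantifiers.
Defines : ∀ L L′ {n} → (∀ {i j} → Formula L′ n i (suc j)) → Set₁
Defines L L′ {n} g = ∀ (K : KripkeTree n) {i j} (ρ : Vector (Node K) i) (θ : Vector WordSet j) X →
  Range L (T K) X ⇔ (Range L′ (T K) X × Sat K ρ (X ∷ᵥ θ) g)

Sat-translate : ∀ {L L′ n} {g : ∀ {i j} → Formula L′ n i (suc j)} → Defines L L′ g →
                ∀ K {i j} ρ θ (φ : Formula L n i j) → Sat K ρ θ φ ⇔ Sat K ρ θ (translate g φ)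
Sat-translate d K ρ θ (P a x)  = ⇔-refl
Sat-translate d K ρ θ (x ≤′ y) = ⇔-refl
Sat-translate d K ρ θ (x ∈′ X) = ⇔-refl
Sat-translate d K ρ θ (¬′ φ)   = ¬-cong-⇔ (Sat-translate d K ρ θ φ)
Sat-translate d K ρ θ (φ ∧′ ψ) = Sat-translate d K ρ θ φ ×-⇔ Sat-translate d K ρ θ ψ
Sat-translate d K ρ θ (∃₁ φ)   = ∃-cong λ v → Sat-translate d K (v ∷ᵥ ρ) θ φ
Sat-translate {g = g} d K ρ θ (∃₂ φ) = ∃-cong λ X →
  let h = d K ρ θ X ; k = Sat-translate d K ρ (X ∷ᵥ θ) φ in mk⇔
  (λ (x , s) → let x′ , γ = to h x in x′ , γ , to k s)
  (λ (x′ , γ , s) → from h (x′ , γ) , from k s)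

defines⇒≤ : ∀ {L L′} (g : ∀ {n i j} → Formula L′ n i (suc j)) → (∀ {n} → Defines L L′ (g {n})) →
            ∀ (C : Class) → L ≤[ C ] L′
defines⇒≤ g d C n φ = translate g φ , λ K _ → Sat-translate {g = g} d K []ᵥ []ᵥ φ

chain-formula : ∀ {n i j} → Formula coWMTL n i (suc j)
chain-formula = ¬′ ∃₁ ∃₁ (v0 ∈′ v0 ∧′ v1 ∈′ v0 ∧′ ¬′ v0 ≤′ v1 ∧′ ¬′ v1 ≤′ v0)

-- `RootedConvex` in the logic. Under the last two quantifiers `v2` is the root, `v1` a member and
-- `v0` a node between them; as a set variable, `v0` is the set just bound.
tree-formula : ∀ {n i j} → Formula coWMSO n i (suc j)
tree-formula = ∃₁ (v0 ∈′ v0 ∧′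
  (¬′ ∃₁ (v0 ∈′ v0 ∧′ ¬′ v1 ≤′ v0)) ∧′
  (¬′ ∃₁ ∃₁ (v1 ∈′ v0 ∧′ v2 ≤′ v0 ∧′ v0 ≤′ v1 ∧′ ¬′ v0 ∈′ v0)))

-- Immediate successor in the tree order. There is no equality atom, so strictness is expressed by
-- negated inequalities.
child-formula : ∀ {L n i j} → Fin i → Fin i → Formula L n i j
child-formula x y = x ≤′ y ∧′ (¬′ y ≤′ x) ∧′
  ¬′ ∃₁ ((¬′ v0 ≤′ suc x) ∧′ v0 ≤′ suc y ∧′ ¬′ suc y ≤′ v0)


-- Coordinates, order and ends of the combs.

Coord : Set
Coord = ℕ × ℕ

word : Coord → Word
word (x , y) = replicate x 0 ++ replicate y 1

-- Defined on all words, with every nonzero letter counted as a 1: a labelling sees the membership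
-- proof only irrelevantly and must read the coordinates off the word.
coords : Word → Coord
coords []          = 0 , 0
coords (zero  ∷ w) = suc (proj₁ (coords w)) , proj₂ (coords w)
coords (suc _ ∷ w) = proj₁ (coords w) , suc (proj₂ (coords w))

coords-word : ∀ c → coords (word c) ≡ c
coords-word (zero  , zero)  = refl
coords-word (zero  , suc y) = cong (map₂ suc) (coords-word (zero , y))
coords-word (suc x , y)     = cong (λ (x′ , y′) → suc x′ , y′) (coords-word (x , y))

word-injective : ∀ {c c′} → word c ≡ word c′ → c ≡ c′
word-injective {c} {c′} eq = trans (sym (coords-word c)) (trans (cong coords eq) (coords-word c′))

length-word : ∀ x y → length (word (x , y)) ≡ x + y
length-word x y = trans (length-++ (replicate x 0)) (cong₂ _+_ (length-replicate x) (length-replicate y))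

replicate-∷ʳ : ∀ n (a : ℕ) → replicate (suc n) a ≡ replicate n a ∷ʳ a
replicate-∷ʳ zero    a = refl
replicate-∷ʳ (suc n) a = cong (a ∷_) (replicate-∷ʳ n a)

word-∷ʳ-spine : ∀ x → word (suc x , 0) ≡ word (x , 0) ∷ʳ 0
word-∷ʳ-spine zero    = refl
word-∷ʳ-spine (suc x) = cong (0 ∷_) (word-∷ʳ-spine x)

word-∷ʳ-tooth : ∀ x y → word (x , suc y) ≡ word (x , y) ∷ʳ 1
word-∷ʳ-tooth x y = trans (cong (replicate x 0 ++_) (replicate-∷ʳ y 1)) (sym (++-assoc (replicate x 0) _ _))

infix 4 _≼_ _≼∞_

-- The prefix order of `word`: a spine node precedes whatever is at or beyond its position, a tooth
-- node only what is at least as high in its own tooth.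
_≼_ : Coord → Coord → Set
(x , y) ≼ (x′ , y′) = (y ≡ 0 × x ≤ x′) ⊎ (x ≡ x′ × y ≤ y′)

≼⇒⊑ : ∀ c c′ → c ≼ c′ → word c ⊑ word c′
≼⇒⊑ (zero  , .0) c′            (inj₁ (refl , _))       = _ , refl
≼⇒⊑ (suc x , .0) (suc x′ , y′) (inj₁ (refl , s≤s x≤x′))
  with v , eq ← ≼⇒⊑ (x , 0) (x′ , y′) (inj₁ (refl , x≤x′)) = v , cong (0 ∷_) eq
≼⇒⊑ (zero  , zero)  (.0 , y′)     (inj₂ (refl , _)) = _ , refl
≼⇒⊑ (zero  , suc y) (.0 , suc y′) (inj₂ (refl , s≤s y≤y′))
  with v , eq ← ≼⇒⊑ (zero , y) (zero , y′) (inj₂ (refl , y≤y′)) = v , cong (1 ∷_) eq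
≼⇒⊑ (suc x , y) (.(suc x) , y′) (inj₂ (refl , y≤y′))
  with v , eq ← ≼⇒⊑ (x , y) (x , y′) (inj₂ (refl , y≤y′)) = v , cong (0 ∷_) eq

⊑⇒≼ : ∀ c c′ → word c ⊑ word c′ → c ≼ c′
⊑⇒≼ (zero  , zero)  c′              _ = inj₁ (refl , z≤n)
⊑⇒≼ (zero  , suc y) (zero  , suc y′) (v , eq) with ⊑⇒≼ (zero , y) (zero , y′) (v , ∷-injectiveʳ eq)
... | inj₁ (refl , _)   = inj₂ (refl , s≤s z≤n)
... | inj₂ (_ , y≤y′)   = inj₂ (refl , s≤s y≤y′)
⊑⇒≼ (zero  , suc y) (zero  , zero)  (v , ())
⊑⇒≼ (zero  , suc y) (suc x′ , y′)   (v , ())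
⊑⇒≼ (suc x , y)     (zero , zero)   (v , ())
⊑⇒≼ (suc x , y)     (zero , suc y′) (v , ())
⊑⇒≼ (suc x , y)     (suc x′ , y′)   (v , eq) with ⊑⇒≼ (x , y) (x′ , y′) (v , ∷-injectiveʳ eq)
... | inj₁ (refl , x≤x′) = inj₁ (refl , s≤s x≤x′)
... | inj₂ (refl , y≤y′) = inj₂ (refl , y≤y′)

⊑-word : ∀ u c → u ⊑ word c → ∃[ c′ ] u ≡ word c′ × c′ ≼ c
⊑-word u c p = let c′ , eq = go u c p in c′ , eq , ⊑⇒≼ c′ c (subst (_⊑ word c) eq p)
  where
  go : ∀ u c → u ⊑ word c → ∃[ c′ ] u ≡ word c′
  go []          c              p        = (0 , 0) , refl
  go (zero  ∷ u) (suc x , y)    (v , eq)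
    with (x′ , y′) , refl ← go u (x , y) (v , ∷-injectiveʳ eq) = (suc x′ , y′) , refl
  go (zero  ∷ u) (zero , suc y) (v , ())
  go (_     ∷ u) (zero , zero)  (v , ())
  go (suc _ ∷ u) (suc x , y)    (v , ())
  go (suc _ ∷ u) (zero , suc y) (v , eq)
    with refl ← ∷-injectiveˡ eq
    with c′ , refl ← go u (zero , y) (v , ∷-injectiveʳ eq)
    -- A prefix of a power of 1 contains no 0, so its spine coordinate is 0.
    with c′ | ⊑⇒≼ c′ (zero , y) (v , ∷-injectiveʳ eq)
  ... | zero , y′ | _                = (zero , suc y′) , refl
  ... | suc _ , _ | inj₁ (_ , ())
  ... | suc _ , _ | inj₂ (() , _)

-- Teeth of a comb are present only if b is true: OnComb false is a bare spine.
OnComb : Bool → Coord → Set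
OnComb b (_ , y) = y ≡ 0 ⊎ b ≡ true

OnComb-≼ : ∀ {b} c c′ → c ≼ c′ → OnComb b c′ → OnComb b c
OnComb-≼ _        _        _                   (inj₂ b≡true) = inj₂ b≡true
OnComb-≼ (x , y)  (x′ , _) (inj₁ (y≡0 , _))    (inj₁ _)      = inj₁ y≡0
OnComb-≼ (x , y)  (x′ , _) (inj₂ (_ , y≤0))    (inj₁ refl)   = inj₁ (n≤0⇒n≡0 y≤0)

Comb : Bool → WordSet
Comb b w = ∃[ c ] OnComb b c × w ≡ word c

word∈Comb⁻ : ∀ {b c} → word c ∈ Comb b → OnComb b c
word∈Comb⁻ {c = c} (c′ , on , eq) with refl ← word-injective {c} {c′} eq = on

-- An end of the comb: nothing is the end of the spine, just e that of the
-- tooth at spine position e.  c ≼∞ e: the ray from the root to e visits c.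
_≼∞_ : Coord → Maybe ℕ → Set
(x , y) ≼∞ nothing = y ≡ 0
(x , y) ≼∞ just e  = (y ≡ 0 × x ≤ e) ⊎ x ≡ e

≼-≼∞-trans : ∀ c c′ e → c ≼ c′ → c′ ≼∞ e → c ≼∞ e
≼-≼∞-trans (x , y) (x′ , y′) nothing  (inj₁ (y≡0 , _))     _                  = y≡0
≼-≼∞-trans (x , y) (x′ , y′) nothing  (inj₂ (_ , y≤0))     refl               = n≤0⇒n≡0 y≤0
≼-≼∞-trans (x , y) (x′ , y′) (just e) (inj₁ (y≡0 , x≤x′))  (inj₁ (_ , x′≤e))  = inj₁ (y≡0 , ≤-trans x≤x′ x′≤e)
≼-≼∞-trans (x , y) (x′ , y′) (just e) (inj₁ (y≡0 , x≤x′))  (inj₂ refl)        = inj₁ (y≡0 , x≤x′)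
≼-≼∞-trans (x , y) (x′ , y′) (just e) (inj₂ (refl , y≤0))  (inj₁ (refl , x≤e)) = inj₁ (n≤0⇒n≡0 y≤0 , x≤e)
≼-≼∞-trans (x , y) (x′ , y′) (just e) (inj₂ (refl , _))    (inj₂ refl)        = inj₂ refl

≼∞-total : ∀ c c′ e → c ≼∞ e → c′ ≼∞ e → c ≼ c′ ⊎ c′ ≼ c
≼∞-total (x , y) (x′ , y′) nothing  refl refl with ≤-total x x′
... | inj₁ p = inj₁ (inj₁ (refl , p))
... | inj₂ p = inj₂ (inj₁ (refl , p))
≼∞-total (x , y) (x′ , y′) (just e) (inj₁ (refl , _)) (inj₁ (refl , _)) with ≤-total x x′
... | inj₁ p = inj₁ (inj₁ (refl , p))
... | inj₂ p = inj₂ (inj₁ (refl , p))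
≼∞-total (x , y) (x′ , y′) (just e) (inj₁ p)    (inj₂ refl) = inj₁ (inj₁ p)
≼∞-total (x , y) (x′ , y′) (just e) (inj₂ refl) (inj₁ p)    = inj₂ (inj₁ p)
≼∞-total (x , y) (x′ , y′) (just e) (inj₂ refl) (inj₂ refl) with ≤-total y y′
... | inj₁ p = inj₁ (inj₂ (refl , p))
... | inj₂ p = inj₂ (inj₂ (refl , p))

IsEnd : Bool → Maybe ℕ → Set
IsEnd b nothing  = ⊤
IsEnd b (just _) = b ≡ true

≼∞⇒OnComb : ∀ {b} c e → IsEnd b e → c ≼∞ e → OnComb b c
≼∞⇒OnComb c nothing  _      y≡0 = inj₁ y≡0
≼∞⇒OnComb c (just e) b≡true _   = inj₂ b≡true

-- Codes of infinite paths.

-- Root and end of an infinite path, which consists of the nodes from the root on that the ray to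
-- this end visits.
Code : Set
Code = Coord × Maybe ℕ

IsCode : Bool → Code → Set
IsCode b (r , e) = r ≼∞ e × IsEnd b e

infix 4 _∈ᶜ_

_∈ᶜ_ : Coord → Code → Set
c ∈ᶜ (r , e) = r ≼ c × c ≼∞ e

⟦_⟧ : Code → WordSet
⟦ κ ⟧ w = ∃[ c ] w ≡ word c × c ∈ᶜ κ

word∈⟦⟧ : ∀ c κ → word c ∈ ⟦ κ ⟧ ⇔ c ∈ᶜ κ
word∈⟦⟧ c κ = mk⇔ f (λ p → c , refl , p)
  where
  f : word c ∈ ⟦ κ ⟧ → c ∈ᶜ κ
  f (c′ , eq , p) with refl ← word-injective {c} {c′} eq = p

-- Both coordinates of a comb word are bounded by its length.
bounded⇒finite : ∀ {b X} → X ⊆ Comb b → ∀ N → (∀ {w} → w ∈ X → length w ≤ N) → Finite X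
bounded⇒finite {X = X} X⊆ N bound = map word (cartesianProduct (upTo (suc N)) (upTo (suc N))) , covers
  where
  covers : ∀ w → w ∈ X → w List.∈ _
  covers w w∈ with (x , y) , _ , refl ← X⊆ w∈ = ∈-map⁺ word (∈-cartesianProduct⁺
    (∈-upTo⁺ (s≤s (m+n≤o⇒m≤o x x+y≤N))) (∈-upTo⁺ (s≤s (m+n≤o⇒n≤o x x+y≤N))))
    where x+y≤N = subst (_≤ N) (length-word x y) (bound w∈)

Unbounded : WordSet → Set
Unbounded X = ∀ N → ∃[ w ] w ∈ X × N < length w

max-length : List Word → ℕ
max-length []       = 0
max-length (w ∷ ws) = length w ⊔ max-length ws

length≤max-length : ∀ {w ws} → w List.∈ ws → length w ≤ max-length ws
length≤max-length {ws = v ∷ ws} (here refl) = m≤m⊔n _ _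
length≤max-length {ws = v ∷ ws} (there p)   = ≤-trans (length≤max-length p) (m≤n⊔m (length v) _)

unbounded⇒infinite : ∀ {X} → Unbounded X → Infinite X
unbounded⇒infinite unbounded (ws , covers) with w , w∈ , long ← unbounded (max-length ws) =
  <⇒≱ long (length≤max-length (covers w w∈))

⟦⟧-unbounded : ∀ κ b → IsCode b κ → Unbounded ⟦ κ ⟧
⟦⟧-unbounded ((x , _) , nothing) b (refl , _) N =
  word (c , 0) , (_ , refl , inj₁ (refl , m≤n+m x (suc N)) , refl) ,
  subst (N <_) (sym (length-word c 0)) (≤-trans (m≤m+n (suc N) x) (m≤m+n c 0))
  where c = suc N + x
⟦⟧-unbounded ((x , y) , just e) b (r≼∞e , _) N =
  word (e , c) , (_ , refl , below r≼∞e , inj₂ refl) ,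
  subst (N <_) (sym (length-word e c)) (≤-trans (m≤m+n (suc N) y) (m≤n+m c e))
  where
  -- Exceeds `N`, and is at least `y` in case the root lies on the tooth `e` itself.
  c = suc N + y
  below : (x , y) ≼∞ just e → (x , y) ≼ (e , c)
  below (inj₁ p)    = inj₁ p
  below (inj₂ refl) = inj₂ (refl , m≤n+m y (suc N))

⟦⟧-path : ∀ b κ → IsCode b κ → Range coWMPL (Comb b) ⟦ κ ⟧
⟦⟧-path b κ@(r , e) valid@(r≼∞e , isEnd) =
  from IsPath⇔Chain ((⊆Comb , from IsTree⇔RootedConvex
    (word r , from (word∈⟦⟧ r κ) (inj₂ (refl , ≤-refl) , r≼∞e) , below , convex)) , chain) ,
  unbounded⇒infinite (⟦⟧-unbounded κ b valid)
  where
  ⊆Comb : ⟦ κ ⟧ ⊆ Comb b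
  ⊆Comb (c , refl , _ , c≼∞e) = c , ≼∞⇒OnComb c e isEnd c≼∞e , refl
  below : ∀ {w} → w ∈ ⟦ κ ⟧ → word r ⊑ w
  below (c , refl , r≼c , _) = ≼⇒⊑ r c r≼c
  convex : ∀ {u w} → w ∈ ⟦ κ ⟧ → word r ⊑ u → u ⊑ w → u ∈ ⟦ κ ⟧
  convex {u} (c′ , refl , _ , c′≼∞e) r⊑u u⊑w with c , refl , c≼c′ ← ⊑-word u c′ u⊑w =
    c , refl , ⊑⇒≼ r c r⊑u , ≼-≼∞-trans c c′ e c≼c′ c′≼∞e
  chain : Chain ⟦ κ ⟧
  chain (c , refl , _ , p) (c′ , refl , _ , q) with ≼∞-total c c′ e p q
  ... | inj₁ c≼c′ = inj₁ (≼⇒⊑ c c′ c≼c′)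
  ... | inj₂ c′≼c = inj₂ (≼⇒⊑ c′ c c′≼c)

-- The labelled combs.

-- Marks the spine, the position 0 where counting starts and the position `m` whose parity is asked
-- for.
label : ℕ → Coord → Subset 3
label m (x , y) = does (y ≟ 0) Vec.∷ does (x ≟ 0) Vec.∷ does (x ≟ m) Vec.∷ Vec.[]

Labelled : ℕ → Coord → Fin 3 → Set
Labelled m (x , y) v0 = y ≡ 0
Labelled m (x , y) v1 = x ≡ 0
Labelled m (x , y) v2 = x ≡ m

does≡true : ∀ {a} {A : Set a} (A? : Dec A) → does A? ≡ true ⇔ A
does≡true (yes a) = mk⇔ (λ _ → a) (λ _ → refl)
does≡true (no ¬a) = mk⇔ (λ ()) (λ a → contradiction a ¬a)

∈-label : ∀ m c a → a ∈ₛ label m c ⇔ Labelled m c a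
∈-label m c@(x , y) a = ⇔-trans (mk⇔ []=⇒lookup (lookup⇒[]= a (label m c))) (go a)
  where
  go : ∀ a → Vec.lookup (label m c) a ≡ true ⇔ Labelled m c a
  go v0 = does≡true (y ≟ 0)
  go v1 = does≡true (x ≟ 0)
  go v2 = does≡true (x ≟ m)

comb : Bool → ℕ → KripkeTree 3
comb b m = record
  { T           = Comb b
  ; isTree      = from IsTree⇔RootedConvex ([] , ((0 , 0) , inj₁ refl , refl) , (λ _ → _ , refl) , convex)
  ; nonBlocking = child
  ; Lab         = λ w _ → label m (coords w)
  }
  where
  convex : ∀ {u w} → w ∈ Comb b → [] ⊑ u → u ⊑ w → u ∈ Comb b
  convex {u} (c′ , on , refl) _ u⊑w with c , refl , c≼c′ ← ⊑-word u c′ u⊑w =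
    c , OnComb-≼ c c′ c≼c′ on , refl
  child : NonBlocking (Comb b)
  child ((x , _) , inj₁ refl , refl) = _ , ((suc x , 0) , inj₁ refl , refl) , 0 , word-∷ʳ-spine x
  child ((x , y) , inj₂ b≡true , refl) = _ , ((x , suc y) , inj₂ b≡true , refl) , 1 , word-∷ʳ-tooth x y

comb-finitelyBranching : ∀ b m → FinitelyBranching (comb b m)
comb-finitelyBranching b m {τ} _ = bounded⇒finite proj₁ (suc (length τ)) bound
  where
  bound : ∀ {σ} → σ ∈ Children (Comb b) τ → length σ ≤ suc (length τ)
  bound (_ , n , refl) = ≤-reflexive (length-∷ʳ τ n)

-- Evaluation in coordinates, and insertion of a spine point.

-- Satisfaction with codes in place of sets. It is first-order, and it agrees with `Sat` when the
-- sets of the logic are exactly the infinite paths of the comb.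
Holds : ∀ {L i j} → Bool → ℕ → Vector Coord i → Vector Code j → Formula L 3 i j → Set
Holds b m η κ (P a x)  = Labelled m (η x) a
Holds b m η κ (x ≤′ y) = η x ≼ η y
Holds b m η κ (x ∈′ X) = η x ∈ᶜ κ X
Holds b m η κ (¬′ φ)   = ¬ Holds b m η κ φ
Holds b m η κ (φ ∧′ ψ) = Holds b m η κ φ × Holds b m η κ ψ
Holds b m η κ (∃₁ φ)   = ∃[ c ] OnComb b c × Holds b m (c ∷ᵥ η) κ φ
Holds b m η κ (∃₂ φ)   = ∃[ X ] IsCode b X × Holds b m η (X ∷ᵥ κ) φ

-- Shift p d x x′: x is not strictly between p and p + d, and x′ is its
-- position after a new point has been inserted into this gap.
Shift : ℕ → ℕ → ℕ → ℕ → Set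
Shift p d x x′ = (x ≤ p × x′ ≡ x) ⊎ (p + d ≤ x × x′ ≡ suc x)

ShiftCoord : ℕ → ℕ → Coord → Coord → Set
ShiftCoord p d (x , y) (x′ , y′) = Shift p d x x′ × y ≡ y′

ShiftCode : ℕ → ℕ → Code → Code → Set
ShiftCode p d (r , e) (r′ , e′) = ShiftCoord p d r r′ × Pointwise (Shift p d) e e′

SubGap : ℕ → ℕ → ℕ → ℕ → Set
SubGap p d p′ d′ = p ≤ p′ × p′ + d′ ≤ p + d

SubGap-trans : ∀ {p d p′ d′ p″ d″} → SubGap p d p′ d′ → SubGap p′ d′ p″ d″ → SubGap p d p″ d″
SubGap-trans (a , b) (a′ , b′) = ≤-trans a a′ , ≤-trans b′ b

module _ {p d p′ d′ : ℕ} (sub : SubGap p d p′ d′) where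

  -- A point outside a gap is outside each subgap, on the same side and with the same image, so
  -- points named earlier stay matched when the gap shrinks.
  Shift-sub : ∀ {x x′} → Shift p d x x′ → Shift p′ d′ x x′
  Shift-sub (inj₁ (x≤p , eq)) = inj₁ (≤-trans x≤p (proj₁ sub) , eq)
  Shift-sub (inj₂ (q≤x , eq)) = inj₂ (≤-trans (proj₂ sub) q≤x , eq)

  ShiftCoord-sub : ∀ {c c′} → ShiftCoord p d c c′ → ShiftCoord p′ d′ c c′
  ShiftCoord-sub (s , eq) = Shift-sub s , eq

  ShiftCode-sub : ∀ {κ κ′} → ShiftCode p d κ κ′ → ShiftCode p′ d′ κ κ′
  ShiftCode-sub (r , nothing) = ShiftCoord-sub r , nothing
  ShiftCode-sub (r , just e)  = ShiftCoord-sub r , just (Shift-sub e)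

module _ {p d : ℕ} (d>0 : 1 ≤ d) where

  -- As `d` is positive, a point that stays lies strictly before one that moves, and so do their
  -- images.
  Shift-≤ : ∀ {x x′ z z′} → Shift p d x x′ → Shift p d z z′ → x ≤ z ⇔ x′ ≤ z′
  Shift-≤ (inj₁ (_ , refl))   (inj₁ (_ , refl))   = ⇔-refl
  Shift-≤ (inj₁ (x≤p , refl)) (inj₂ (q≤z , refl)) = mk⇔ m≤n⇒m≤1+n
    (λ _ → ≤-trans x≤p (≤-trans (m≤m+n p d) q≤z))
  Shift-≤ (inj₂ (q≤x , refl)) (inj₁ (z≤p , refl)) = mk⇔
    (λ x≤z → contradiction (≤-trans x≤z z≤p) (<⇒≱ p<x))
    (λ x<z → contradiction (≤-trans (n≤1+n _) (≤-trans x<z z≤p)) (<⇒≱ p<x))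
    where p<x = ≤-trans (≤-trans (≤-reflexive (+-comm 1 p)) (+-monoʳ-≤ p d>0)) q≤x
  Shift-≤ (inj₂ (_ , refl))   (inj₂ (_ , refl))   = mk⇔ s≤s s≤s⁻¹

  Shift-≡ : ∀ {x x′ z z′} → Shift p d x x′ → Shift p d z z′ → x ≡ z ⇔ x′ ≡ z′
  Shift-≡ s t = mk⇔
    (λ eq → ≤-antisym (to (Shift-≤ s t) (≤-reflexive eq)) (to (Shift-≤ t s) (≤-reflexive (sym eq))))
    (λ eq → ≤-antisym (from (Shift-≤ s t) (≤-reflexive eq)) (from (Shift-≤ t s) (≤-reflexive (sym eq))))

  ShiftCoord-≼ : ∀ {c c′ z z′} → ShiftCoord p d c c′ → ShiftCoord p d z z′ → c ≼ z ⇔ c′ ≼ z′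
  ShiftCoord-≼ (s , refl) (t , refl) = (⇔-refl ×-⇔ Shift-≤ s t) ⊎-⇔ (Shift-≡ s t ×-⇔ ⇔-refl)

  Shift-≼∞ : ∀ {c c′ e e′} → ShiftCoord p d c c′ → Pointwise (Shift p d) e e′ → c ≼∞ e ⇔ c′ ≼∞ e′
  Shift-≼∞ (s , refl) nothing  = ⇔-refl
  Shift-≼∞ (s , refl) (just t) = (⇔-refl ×-⇔ Shift-≤ s t) ⊎-⇔ Shift-≡ s t

  Shift-∈ᶜ : ∀ {c c′ κ κ′} → ShiftCoord p d c c′ → ShiftCode p d κ κ′ → c ∈ᶜ κ ⇔ c′ ∈ᶜ κ′
  Shift-∈ᶜ s (r , e) = ShiftCoord-≼ r s ×-⇔ Shift-≼∞ s e

  IsCode-shift : ∀ {b κ κ′} → ShiftCode p d κ κ′ → IsCode b κ ⇔ IsCode b κ′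
  IsCode-shift (r , nothing) = Shift-≼∞ r nothing ×-⇔ ⇔-refl
  IsCode-shift (r , just e)  = Shift-≼∞ r (just e) ×-⇔ ⇔-refl

  Labelled-shift : ∀ {m c c′} → p + d ≤ m → ShiftCoord p d c c′ → ∀ a → Labelled m c a ⇔ Labelled (suc m) c′ a
  Labelled-shift q≤m (s , refl) v0 = ⇔-refl
  Labelled-shift q≤m (s , refl) v1 = Shift-≡ s (inj₁ (z≤n , refl))
  Labelled-shift q≤m (s , refl) v2 = Shift-≡ s (inj₂ (q≤m , refl))

module _ {p d h : ℕ} (h+h≤d : h + h ≤ d) where

  lower-half : SubGap p d p h
  lower-half = ≤-refl , +-monoʳ-≤ p (m+n≤o⇒m≤o h h+h≤d)

  upper-half : SubGap p d (p + h) h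
  upper-half = m≤m+n p h , subst (_≤ p + d) (sym (+-assoc p h h)) (+-monoʳ-≤ p h+h≤d)

  -- If `x` is at most `p + h`, the insertion goes to the upper half and `x` stays; otherwise it
  -- goes to the lower half and `x` moves up by one.
  Shift-forth : ∀ x → ∃[ p′ ] SubGap p d p′ h × ∃[ x′ ] Shift p′ h x x′
  Shift-forth x with ≤-total x (p + h)
  ... | inj₁ x≤ = p + h , upper-half , x , inj₁ (x≤ , refl)
  ... | inj₂ ≤x = p , lower-half , suc x , inj₂ (≤x , refl)

  Shift-back : ∀ x′ → ∃[ p′ ] SubGap p d p′ h × ∃[ x ] Shift p′ h x x′
  Shift-back x′ with x′ ≤? p + h
  ... | yes x′≤ = p + h , upper-half , x′ , inj₁ (x′≤ , refl)
  Shift-back zero    | no 0≰ = contradiction z≤n 0≰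
  -- Above `p + h` the answer is the predecessor, which is still at least `p + h`.
  Shift-back (suc x) | no x≰ = p , lower-half , x , inj₂ (s≤s⁻¹ (≰⇒> x≰) , refl)

module _ {p d h : ℕ} (4h≤d : (h + h) + (h + h) ≤ d) where

  ShiftCode-forth : ∀ κ → ∃[ p′ ] SubGap p d p′ h × ∃[ κ′ ] ShiftCode p′ h κ κ′
  ShiftCode-forth ((x , y) , e) with p₁ , sub , x′ , s ← Shift-forth {p} {h = h + h} 4h≤d x with e
  -- With no tooth to place, a half is taken all the same, so that the gap has length `h` in both
  -- cases.
  ... | nothing = p₁ , SubGap-trans sub half , (_ , nothing) , (Shift-sub half s , refl) , nothing
    where half = lower-half {p₁} {h + h} ≤-refl
  ... | just z with p₂ , sub₂ , z′ , t ← Shift-forth {p₁} {h = h} ≤-refl z =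
    p₂ , SubGap-trans sub sub₂ , (_ , just z′) , (Shift-sub sub₂ s , refl) , just t

  ShiftCode-back : ∀ κ′ → ∃[ p′ ] SubGap p d p′ h × ∃[ κ ] ShiftCode p′ h κ κ′
  ShiftCode-back ((x′ , y) , e) with p₁ , sub , x , s ← Shift-back {p} {h = h + h} 4h≤d x′ with e
  ... | nothing = p₁ , SubGap-trans sub half , (_ , nothing) , (Shift-sub half s , refl) , nothing
    where half = lower-half {p₁} {h + h} ≤-refl
  ... | just z′ with p₂ , sub₂ , z , t ← Shift-back {p₁} {h = h} ≤-refl z′ =
    p₂ , SubGap-trans sub sub₂ , (_ , just z) , (Shift-sub sub₂ s , refl) , just t

-- Each quantified point halves the gap; a path has up to two end points, its
-- root and the tooth it climbs.
gap : ∀ {L n i j} → Formula L n i j → ℕ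
gap (P a x)  = 1
gap (x ≤′ y) = 1
gap (x ∈′ X) = 1
gap (¬′ φ)   = gap φ
gap (φ ∧′ ψ) = gap φ + gap ψ
gap (∃₁ φ)   = gap φ + gap φ
gap (∃₂ φ)   = (gap φ + gap φ) + (gap φ + gap φ)

gap-positive : ∀ {L n i j} (φ : Formula L n i j) → 1 ≤ gap φ
gap-positive (P a x)  = ≤-refl
gap-positive (x ≤′ y) = ≤-refl
gap-positive (x ∈′ X) = ≤-refl
gap-positive (¬′ φ)   = gap-positive φ
gap-positive (φ ∧′ ψ) = ≤-trans (gap-positive φ) (m≤m+n _ _)
gap-positive (∃₁ φ)   = ≤-trans (gap-positive φ) (m≤m+n _ _)
gap-positive (∃₂ φ)   = ≤-trans (gap-positive φ) (≤-trans (m≤m+n _ _) (m≤m+n _ _))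

ext : ∀ {a b r n} {A : Set a} {B : Set b} {R : A → B → Set r} {x y} {xs : Vector A n} {ys : Vector B n} →
      R x y → (∀ i → R (xs i) (ys i)) → ∀ i → R ((x ∷ᵥ xs) i) ((y ∷ᵥ ys) i)
ext r rs zero    = r
ext r rs (suc i) = rs i

-- An Ehrenfeucht-Fraïssé game by induction on the formula: each quantified object is answered in
-- the other comb, and play goes on in a subgap that avoids it and is long enough for the body. The
-- bound `p + d ≤ m` keeps the gap before the marked position.
Holds-shift : ∀ {L i j b m p d} (φ : Formula L 3 i j) → gap φ ≤ d → p + d ≤ m →
  ∀ {η η′ κ κ′} → (∀ x → ShiftCoord p d (η x) (η′ x)) → (∀ X → ShiftCode p d (κ X) (κ′ X)) →
  Holds b m η κ φ ⇔ Holds b (suc m) η′ κ′ φ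
Holds-shift (P a x)  d>0 q≤m s t = Labelled-shift d>0 q≤m (s x) a
Holds-shift (x ≤′ y) d>0 q≤m s t = ShiftCoord-≼ d>0 (s x) (s y)
Holds-shift (x ∈′ X) d>0 q≤m s t = Shift-∈ᶜ d>0 (s x) (t X)
Holds-shift (¬′ φ)   g≤d q≤m s t = ¬-cong-⇔ (Holds-shift φ g≤d q≤m s t)
Holds-shift (φ ∧′ ψ) g≤d q≤m s t =
  Holds-shift φ (m+n≤o⇒m≤o _ g≤d) q≤m s t ×-⇔ Holds-shift ψ (m+n≤o⇒n≤o _ g≤d) q≤m s t
Holds-shift {b = b} {m} {p} {d} (∃₁ φ) g≤d q≤m {η} {η′} {κ} {κ′} s t = mk⇔
  (λ ((x , y) , on , holds) → let p′ , sub , x′ , sx = Shift-forth {p} g≤d x in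
    (x′ , y) , on , to (step sub (sx , refl)) holds)
  (λ ((x′ , y) , on , holds) → let p′ , sub , x , sx = Shift-back {p} g≤d x′ in
    (x , y) , on , from (step sub (sx , refl)) holds)
  where
  step : ∀ {p′ c c′} → SubGap p d p′ (gap φ) → ShiftCoord p′ (gap φ) c c′ →
         Holds b m (c ∷ᵥ η) κ φ ⇔ Holds b (suc m) (c′ ∷ᵥ η′) κ′ φ
  step {p′} sub sc = Holds-shift φ ≤-refl (≤-trans (proj₂ sub) q≤m)
    (ext {R = ShiftCoord p′ (gap φ)} sc (λ x → ShiftCoord-sub sub (s x))) (λ X → ShiftCode-sub sub (t X))
Holds-shift {b = b} {m} {p} {d} (∃₂ φ) g≤d q≤m {η} {η′} {κ} {κ′} s t = mk⇔
  (λ (X , valid , holds) → let p′ , sub , X′ , sX = ShiftCode-forth {p} g≤d X in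
    X′ , to (IsCode-shift gap>0 sX) valid , to (step sub sX) holds)
  (λ (X′ , valid , holds) → let p′ , sub , X , sX = ShiftCode-back {p} g≤d X′ in
    X , from (IsCode-shift gap>0 sX) valid , from (step sub sX) holds)
  where
  gap>0 = gap-positive φ
  step : ∀ {p′ X X′} → SubGap p d p′ (gap φ) → ShiftCode p′ (gap φ) X X′ →
         Holds b m η (X ∷ᵥ κ) φ ⇔ Holds b (suc m) η′ (X′ ∷ᵥ κ′) φ
  step {p′} sub sX = Holds-shift φ ≤-refl (≤-trans (proj₂ sub) q≤m)
    (λ x → ShiftCoord-sub sub (s x)) (ext {R = ShiftCode p′ (gap φ)} sX (λ X → ShiftCode-sub sub (t X)))

-- The parity sentences and their witnesses.

Even : ℕ → Set
Even zero    = ⊤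
Even (suc n) = ¬ Even n

-- marks x says that a mark above the spine node x lies in the set.
even-formula : ∀ {L} → (∀ {i} → Fin i → Formula L 3 i 1) → Sentence L 3
even-formula marks = ∃₂ (
  ∃₁ (P v0 v0 ∧′ P v1 v0 ∧′ marks v0) ∧′
  ∃₁ (P v0 v0 ∧′ P v2 v0 ∧′ marks v0) ∧′
  (¬′ ∃₁ ∃₁ (P v0 v1 ∧′ P v0 v0 ∧′ child-formula v1 v0 ∧′ marks v1 ∧′ marks v0)) ∧′
  (¬′ ∃₁ ∃₁ (P v0 v1 ∧′ P v0 v0 ∧′ child-formula v1 v0 ∧′ (¬′ marks v1) ∧′ ¬′ marks v0)))

spine-mark : ∀ {L i} → Fin i → Formula L 3 i 1
spine-mark x = x ∈′ v0

-- A subtree containing the spine is free to contain or omit the first node of each tooth; this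
-- choice encodes a set of spine positions.
tooth-mark : ∀ {L i} → Fin i → Formula L 3 i 1
tooth-mark x = ∃₁ (v0 ∈′ v0 ∧′ (¬′ P v0 v0) ∧′ child-formula (suc x) v0)

-- Common interface of the two kinds of marks, at height 0 on the spine and 1 on the teeth, so that
-- one argument serves both parity sentences.
MarksHeight : ∀ {L} → Bool → ℕ → (∀ {i} → Fin i → Formula L 3 i 1) → Set₁
MarksHeight b t marks = ∀ m {i} (ρ : Vector (Node (comb b m)) i) X x k → proj₁ (ρ x) ≡ word (k , 0) →
  Sat (comb b m) ρ (X ∷ᵥ []ᵥ) (marks x) ⇔ word (k , t) ∈ X

spine-marks : ∀ {L b} → MarksHeight {L} b 0 spine-mark
spine-marks m ρ X x k eq = lift-⇔ (mk⇔ (subst X eq) (subst X (sym eq)))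

Sat-P : ∀ {L b m i j} (ρ : Vector (Node (comb b m)) i) (θ : Vector WordSet j) x c a → proj₁ (ρ x) ≡ word c →
        Sat {L} (comb b m) ρ θ (P a x) ⇔ Labelled m c a
Sat-P {m = m} ρ θ x c a eq = lift-⇔ (subst (λ c′ → a ∈ₛ label m c′ ⇔ Labelled m c a)
  (sym (trans (cong coords eq) (coords-word c))) (∈-label m c a))

spine-node : ∀ {b m} → ℕ → Node (comb b m)
spine-node k = word (k , 0) , (k , 0) , inj₁ refl , refl

spine-child : ∀ {k k′ n} → word (k′ , 0) ≡ word (k , 0) ∷ʳ n → k′ ≡ suc k
spine-child {k} {k′} {n} eq = begin
  k′                          ≡⟨ sym (+-identityʳ k′) ⟩
  k′ + 0                      ≡⟨ sym (length-word k′ 0) ⟩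
  length (word (k′ , 0))      ≡⟨ cong length eq ⟩
  length (word (k , 0) ∷ʳ n)  ≡⟨ length-∷ʳ (word (k , 0)) n ⟩
  suc (length (word (k , 0))) ≡⟨ cong suc (length-word k 0) ⟩
  suc (k + 0)                 ≡⟨ cong suc (+-identityʳ k) ⟩
  suc k                       ∎
  where open ≡-Reasoning

tooth-child : ∀ {k x y n} → ¬ y ≡ 0 → word (x , y) ≡ word (k , 0) ∷ʳ n → (x , y) ≡ (k , 1)
tooth-child {k} {x} {zero}  {n} y≢0 eq = contradiction refl y≢0
tooth-child {k} {x} {suc y} {n} y≢0 eq = on-tooth (⊑⇒≼ (k , 0) (x , suc y) ([ n ] , eq))
  where
  lengths : x + suc y ≡ suc (k + 0)
  lengths = trans (sym (length-word x (suc y))) (trans (cong length eq)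
    (trans (length-∷ʳ (word (k , 0)) n) (cong suc (length-word k 0))))
  lengths′ : x + y ≡ k
  lengths′ = suc-injective (trans (sym (+-suc x y)) (trans lengths (cong suc (+-identityʳ k))))
  on-tooth : (k , 0) ≼ (x , suc y) → (x , suc y) ≡ (k , 1)
  on-tooth (inj₁ (_ , k≤x)) = same (≤-antisym k≤x (subst (x ≤_) lengths′ (m≤m+n x y)))
    where
    same : k ≡ x → (x , suc y) ≡ (k , 1)
    same refl = cong (λ z → k , suc z) (+-cancelˡ-≡ k y 0 (trans lengths′ (sym (+-identityʳ k))))
  on-tooth (inj₂ (refl , _)) = cong (λ z → k , suc z) (+-cancelˡ-≡ k y 0 (trans lengths′ (sym (+-identityʳ k))))

even-spine : WordSet
even-spine w = ∃[ k ] Even k × w ≡ word (k , 0)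

-- The whole spine makes this set infinite and keeps it a tree whichever first tooth nodes are
-- added.
even-teeth : WordSet
even-teeth w = Σ Coord λ (k , y) → (y ≡ 0 ⊎ (y ≡ 1 × Even k)) × w ≡ word (k , y)

-- Definability of children, paths and subtrees.

module Classical (em : ∀ {ℓ} → ExcludedMiddle ℓ) where

  stable : ∀ {ℓ} {A : Set ℓ} → ¬ ¬ A → A
  stable = decidable-stable em

  Sat-child : ∀ {L n i j} (K : KripkeTree n) (ρ : Vector (Node K) i) (θ : Vector WordSet j) x y →
              Sat K ρ θ (child-formula {L} x y) ⇔ (∃[ n ] proj₁ (ρ y) ≡ proj₁ (ρ x) ∷ʳ n)
  Sat-child K ρ θ x y = mk⇔ f g
    where
    u = proj₁ (ρ x)
    w = proj₁ (ρ y)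
    f : _ → ∃[ n ] w ≡ u ∷ʳ n
    f (lift ([]    , eq) , y≰x , _) = contradiction (lift (subst (_⊑ u) (sym (trans eq (++-identityʳ u))) ⊑-refl)) y≰x
    f (lift (n ∷ v , eq) , y≰x , none) = n , sym (⊑-length-≡ z⊑w (⊑-length w⊑z))
      where
      -- The first node after `u` on the way to `w`. It is not strictly between them, so `w` is a
      -- prefix of it and, by length, equal to it.
      z = u ∷ʳ n
      z⊑w : z ⊑ w
      z⊑w = v , trans eq (sym (∷ʳ-++ u n v))
      z∈ : z ∈ T K
      z∈ = tree-convex (isTree K) (proj₂ (ρ x)) (proj₂ (ρ y)) (_ , refl) z⊑w
      w⊑z : w ⊑ z
      w⊑z = stable λ w⋢z → none ((z , z∈) ,
        (λ (lift z⊑u) → <⇒≱ (≤-reflexive (sym (length-∷ʳ u n))) (⊑-length z⊑u)) ,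
        lift z⊑w , w⋢z ∘ lower)
    g : ∃[ n ] w ≡ u ∷ʳ n → _
    g (n , eq) = lift (_ , eq) ,
      (λ (lift w⊑u) → <⇒≱ (≤-reflexive (trans (sym (length-∷ʳ u n)) (cong length (sym eq)))) (⊑-length w⊑u)) ,
      λ ((z , _) , z⋢u , lift z⊑w , w⋢z) → case z⋢u w⋢z (⊑-∷ʳ (subst (z ⊑_) eq z⊑w))
      where
      case : ∀ {z} → ¬ Lift (lsuc 0ℓ) (z ⊑ u) → ¬ Lift (lsuc 0ℓ) (w ⊑ z) → z ⊑ u ⊎ z ≡ u ∷ʳ n → ⊥
      case z⋢u w⋢z (inj₁ z⊑u) = z⋢u (lift z⊑u)
      case z⋢u w⋢z (inj₂ z≡w) = w⋢z (lift (subst (w ⊑_) (trans eq (sym z≡w)) ⊑-refl))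

  chain-defines : ∀ {n} → Defines coWMPL coWMTL {n} chain-formula
  chain-defines K ρ θ X = mk⇔
    (λ (path , inf) → let s , chain = to IsPath⇔Chain path in (s , inf) ,
      λ (_ , _ , lift w∈ , lift u∈ , w⋢u , u⋢w) → [ u⋢w ∘ lift , w⋢u ∘ lift ]′ (chain u∈ w∈))
    (λ ((s , inf) , none) → from IsPath⇔Chain (s , λ u∈ w∈ → stable λ incomparable →
      none ((_ , proj₁ s u∈) , (_ , proj₁ s w∈) , lift w∈ , lift u∈ ,
        incomparable ∘ inj₂ ∘ lower , incomparable ∘ inj₁ ∘ lower)) , inf)

  tree-defines : ∀ {n} → Defines coWMTL coWMSO {n} tree-formula
  tree-defines K ρ θ X = mk⇔
    (λ ((X⊆T , t) , inf) → let r , r∈ , below , convex = to IsTree⇔RootedConvex t in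
      (X⊆T , inf) , (r , X⊆T r∈) , lift r∈ ,
      (λ (_ , lift w∈ , r⋢w) → r⋢w (lift (below w∈))) ,
      λ (_ , _ , lift w∈ , lift r⊑u , lift u⊑w , u∉) → u∉ (lift (convex w∈ r⊑u u⊑w)))
    (λ ((X⊆T , inf) , (r , r∈T) , lift r∈ , none-apart , none-missing) →
      (X⊆T , from IsTree⇔RootedConvex (r , r∈ ,
        (λ w∈ → stable λ r⋢w → none-apart ((_ , X⊆T w∈) , lift w∈ , r⋢w ∘ lower)) ,
        λ w∈ r⊑u u⊑w → stable λ u∉ →
          none-missing ((_ , X⊆T w∈) , (_ , tree-convex (isTree K) r∈T (X⊆T w∈) r⊑u u⊑w) ,
            lift w∈ , lift r⊑u , lift u⊑w , u∉ ∘ lower))) , inf)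

  -- Inexpressibility of parity.

  -- Being infinite, `X` has arbitrarily long nodes. If all are on the spine, it runs along the
  -- spine for ever. If one is on tooth `e` off the spine, comparability with it confines `X` to the
  -- ray up that tooth, and length forces `X` to climb it.
  path-code : ∀ {b X} → Range coWMPL (Comb b) X →
              ∃[ κ ] IsCode b κ × (∀ c → OnComb b c → word c ∈ X ⇔ c ∈ᶜ κ)
  path-code {b} {X} (path , inf)
    with (X⊆ , t) , chain ← to IsPath⇔Chain path
    with _ , r∈ , below , convex ← to IsTree⇔RootedConvex t
    with r , onr , refl ← X⊆ r∈ = cases em
    where
    unbounded : Unbounded X
    unbounded N = stable λ none → inf (bounded⇒finite X⊆ N λ {w} w∈ →
      ≮⇒≥ λ N<w → none (w , w∈ , N<w))
    long : ∀ N → ∃[ (x , y) ] word (x , y) ∈ X × N < x + y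
    long N with w , w∈ , N<w ← unbounded N with (x , y) , _ , refl ← X⊆ w∈ =
      (x , y) , w∈ , subst (N <_) (length-word x y) N<w
    below′ : ∀ c → word c ∈ X → r ≼ c
    below′ c c∈ = ⊑⇒≼ r c (below c∈)
    convex′ : ∀ c c′ → word c′ ∈ X → r ≼ c → c ≼ c′ → word c ∈ X
    convex′ c c′ c′∈ r≼c c≼c′ = convex c′∈ (≼⇒⊑ r c r≼c) (≼⇒⊑ c c′ c≼c′)
    comparable : ∀ c c′ → word c ∈ X → word c′ ∈ X → c ≼ c′ ⊎ c′ ≼ c
    comparable c c′ c∈ c′∈ with chain c∈ c′∈
    ... | inj₁ p = inj₁ (⊑⇒≼ c c′ p)
    ... | inj₂ p = inj₂ (⊑⇒≼ c′ c p)
    MeetsTooth : Set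
    MeetsTooth = ∃[ e ] ∃[ y ] word (e , suc y) ∈ X
    Coded : Set
    Coded = ∃[ κ ] IsCode b κ × (∀ c → OnComb b c → word c ∈ X ⇔ c ∈ᶜ κ)
    cases : Dec MeetsTooth → Coded
    cases (no misses) = (r , nothing) , (spine r r∈ , tt) ,
      λ c _ → mk⇔ (λ c∈ → below′ c c∈ , spine c c∈) (λ (r≼c , p) → onto c r≼c p)
      where
      spine : ∀ c → word c ∈ X → c ≼∞ nothing
      spine (x , zero)  _  = refl
      spine (x , suc y) c∈ = contradiction (x , y , c∈) misses
      onto : ∀ c → r ≼ c → c ≼∞ nothing → word c ∈ X
      onto c@(x , .0) r≼c refl with (x′ , y′) , c′∈ , x<c′ ← long x with refl ← spine (x′ , y′) c′∈ =
        convex′ c (x′ , 0) c′∈ r≼c (inj₁ (refl , <⇒≤ (subst (x <_) (+-identityʳ x′) x<c′)))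
    cases (yes (e , y₀ , tooth∈)) = (r , just e) , (end r r∈ , teeth) ,
      λ c _ → mk⇔ (λ c∈ → below′ c c∈ , end c c∈) (λ (r≼c , p) → onto c r≼c p)
      where
      tooth : Coord
      tooth = e , suc y₀
      teeth : b ≡ true
      teeth with word∈Comb⁻ {c = tooth} (X⊆ tooth∈)
      ... | inj₂ b≡true = b≡true
      end : ∀ c → word c ∈ X → c ≼∞ just e
      end c c∈ with comparable c tooth c∈ tooth∈
      ... | inj₁ c≼tooth              = ≼-≼∞-trans c tooth (just e) c≼tooth (inj₂ refl)
      ... | inj₂ (inj₂ (refl , _))    = inj₂ refl
      high : ∀ y → ∃[ y′ ] word (e , y′) ∈ X × y ≤ y′
      -- A node longer than `e` is not on the spine up to `e`, so it is on the tooth; cancelling `e`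
      -- leaves a height above `y`.
      high y with (x′ , y′) , c′∈ , long′ ← long (e + (y + suc y₀)) with end (x′ , y′) c′∈
      ... | inj₁ (refl , x′≤e) = contradiction
        (≤-trans (≤-reflexive (+-identityʳ x′)) (≤-trans x′≤e (m≤m+n e _))) (<⇒≱ long′)
      ... | inj₂ refl = y′ , c′∈ , ≤-trans (m≤m+n y (suc y₀)) (<⇒≤ (+-cancelˡ-< e _ _ long′))
      onto : ∀ c → r ≼ c → c ≼∞ just e → word c ∈ X
      onto c@(x , y) r≼c (inj₁ (y≡0 , x≤e)) = convex′ c tooth tooth∈ r≼c (inj₁ (y≡0 , x≤e))
      onto c@(x , y) r≼c (inj₂ refl) with y′ , c′∈ , y≤y′ ← high y =
        convex′ c (e , y′) c′∈ r≼c (inj₂ (refl , y≤y′))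

  -- What the inexpressibility proof asks of a logic: `coWMPL` has it on every comb, `coWMTL` on the
  -- bare spine, where any two nodes are comparable.
  RangesOverPaths : Logic → Bool → Set₁
  RangesOverPaths L b = ∀ X → Range L (Comb b) X ⇔ Range coWMPL (Comb b) X

  spine-paths : RangesOverPaths coWMTL false
  spine-paths X = mk⇔ (λ (s , inf) → from IsPath⇔Chain (s , chain (proj₁ s)) , inf)
    (λ ((s , _) , inf) → s , inf)
    where
    chain : X ⊆ Comb false → Chain X
    chain X⊆ u∈ w∈ with X⊆ u∈ | X⊆ w∈
    ... | (x , _) , inj₁ refl , refl | (x′ , _) , inj₁ refl , refl with ≤-total x x′
    ... | inj₁ p = inj₁ (≼⇒⊑ (x , 0) (x′ , 0) (inj₁ (refl , p)))
    ... | inj₂ p = inj₂ (≼⇒⊑ (x′ , 0) (x , 0) (inj₁ (refl , p)))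

  module _ {L b} (paths : RangesOverPaths L b) where

    -- At a set quantifier, `path-code` gives a code for each set and `⟦_⟧` a set for each code.
    -- They have to agree on comb nodes only, as variables take no other values.
    Sat⇔Holds : ∀ {m i j} (φ : Formula L 3 i j) {ρ : Vector (Node (comb b m)) i} {η θ κ} →
      (∀ x → proj₁ (ρ x) ≡ word (η x)) → (∀ X c → OnComb b c → word c ∈ θ X ⇔ c ∈ᶜ κ X) →
      Sat (comb b m) ρ θ φ ⇔ Holds b m η κ φ
    Sat⇔Holds (P a x) {ρ} {η} {θ} eq code = Sat-P {L} ρ θ x (η x) a (eq x)
    Sat⇔Holds (x ≤′ y) {ρ} {η} eq code = lift-⇔ (subst₂ (λ u w → u ⊑ w ⇔ η x ≼ η y)
      (sym (eq x)) (sym (eq y)) (mk⇔ (⊑⇒≼ (η x) (η y)) (≼⇒⊑ (η x) (η y))))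
    Sat⇔Holds (x ∈′ X) {ρ} {η} {θ} {κ} eq code = lift-⇔ (subst (λ u → u ∈ θ X ⇔ η x ∈ᶜ κ X) (sym (eq x))
      (code X (η x) (word∈Comb⁻ (subst (Comb b) (eq x) (proj₂ (ρ x))))))
    Sat⇔Holds (¬′ φ) eq code = ¬-cong-⇔ (Sat⇔Holds φ eq code)
    Sat⇔Holds (φ ∧′ ψ) eq code = Sat⇔Holds φ eq code ×-⇔ Sat⇔Holds ψ eq code
    Sat⇔Holds {m} (∃₁ φ) {ρ} {η} {θ} {κ} eq code = mk⇔
      (λ ((w , c , on , w≡c) , sat) → c , on , to (Sat⇔Holds φ (ext {R = R} w≡c eq) code) sat)
      (λ (c , on , holds) → (word c , c , on , refl) , from (Sat⇔Holds φ (ext {R = R} refl eq) code) holds)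
      where
      R : Node (comb b m) → Coord → Set
      R v c = proj₁ v ≡ word c
    Sat⇔Holds (∃₂ φ) {ρ} {η} {θ} {κ} eq code = mk⇔
      (λ (X , range , sat) → let κ , valid , h = path-code (to (paths X) range) in
        κ , valid , to (Sat⇔Holds φ eq (ext {R = R} h code)) sat)
      (λ (κ , valid , holds) → ⟦ κ ⟧ , from (paths ⟦ κ ⟧) (⟦⟧-path b κ valid) ,
        from (Sat⇔Holds φ eq (ext {R = R} (λ c _ → word∈⟦⟧ c κ) code)) holds)
      where
      R : WordSet → Code → Set
      R X κ = ∀ c → OnComb b c → word c ∈ X ⇔ c ∈ᶜ κ

    insertion : ∀ (φ : Sentence L 3) → comb b (gap φ) ⊨ φ ⇔ comb b (suc (gap φ)) ⊨ φ
    insertion φ = ⇔-trans (at (gap φ)) (⇔-trans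
      -- With no point named, the stretch from 0 to the marked position is one gap, of length
      -- exactly `gap φ`.
      (Holds-shift {p = 0} φ ≤-refl ≤-refl (λ ()) (λ ())) (⇔-sym (at (suc (gap φ)))))
      where
      at : ∀ m → comb b m ⊨ φ ⇔ Holds b m []ᵥ []ᵥ φ
      at m = Sat⇔Holds {m} φ (λ ()) (λ ())

    -- A sentence `φ` equivalent to `ψ` would have the same truth value at `gap φ` and its
    -- successor, of which exactly one is even.
    even-inexpressible : ∀ {C : Class} {L′} → (∀ m → C (comb b m)) →
      (ψ : Sentence L′ 3) → (∀ m → comb b m ⊨ ψ ⇔ Even m) → ¬ (L′ ≤[ C ] L)
    even-inexpressible combs ψ even le with φ , equiv ← le 3 ψ
      = ¬even even′
      where
      m = gap φ
      even⇔ : Even m ⇔ (¬ Even m)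
      even⇔ = ⇔-trans (⇔-sym (even m)) (⇔-trans (equiv (comb b m) (combs m)) (⇔-trans (insertion φ)
        (⇔-trans (⇔-sym (equiv (comb b (suc m)) (combs (suc m)))) (even (suc m)))))
      ¬even : ¬ Even m
      ¬even e = to even⇔ e e
      even′ : Even m
      even′ = from even⇔ ¬even

  -- Correctness of the parity sentences.

  tooth-marks : ∀ {L} → MarksHeight {L} true 1 tooth-mark
  tooth-marks {L} m ρ X x k eq = mk⇔ f g
    where
    f : Sat (comb true m) ρ (X ∷ᵥ []ᵥ) (tooth-mark {L} x) → word (k , 1) ∈ X
    f (v@(w , c , on , refl) , lift w∈ , off-spine , child)
      with n , e ← to (Sat-child {L} (comb true m) (v ∷ᵥ ρ) (X ∷ᵥ []ᵥ) (suc x) v0) child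
      with refl ← tooth-child {k} (off-spine ∘ from (Sat-P {L} (v ∷ᵥ ρ) (X ∷ᵥ []ᵥ) v0 c v0 refl))
        (trans e (cong (_∷ʳ n) eq)) = w∈
    g : word (k , 1) ∈ X → Sat (comb true m) ρ (X ∷ᵥ []ᵥ) (tooth-mark {L} x)
    g w∈ = v , lift w∈ ,
      (λ s → contradiction (to (Sat-P {L} (v ∷ᵥ ρ) (X ∷ᵥ []ᵥ) v0 (k , 1) v0 refl) s) λ ()) ,
      from (Sat-child {L} (comb true m) (v ∷ᵥ ρ) (X ∷ᵥ []ᵥ) (suc x) v0)
        (1 , trans (word-∷ʳ-tooth k 0) (cong (_∷ʳ 1) (sym eq)))
      where
      v : Node (comb true m)
      v = word (k , 1) , (k , 1) , inj₂ refl , refl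

  module _ {L b t} (marks : ∀ {i} → Fin i → Formula L 3 i 1) (height : MarksHeight b t marks)
           (evens : WordSet) (range : Range L (Comb b) evens) (evens⇔ : ∀ k → word (k , t) ∈ evens ⇔ Even k) where

    spine-position : ∀ {m i} (ρ : Vector (Node (comb b m)) i) X x →
      Sat {L} (comb b m) ρ (X ∷ᵥ []ᵥ) (P v0 x) → ∃[ k ] proj₁ (ρ x) ≡ word (k , 0)
    spine-position ρ X x s with c@(k , _) , _ , eq ← proj₂ (ρ x)
      with refl ← to (Sat-P {L} ρ (X ∷ᵥ []ᵥ) x c v0 eq) s = k , eq

    -- A witness marks 0 and exactly one of any two consecutive spine positions, hence by induction
    -- the even ones, and it marks `m`. For even `m`, `evens` is a witness.
    even-expressible : ∀ m → comb b m ⊨ even-formula marks ⇔ Even m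
    even-expressible m = mk⇔ f g
      where
      K = comb b m
      node : ℕ → Node K
      node = spine-node {b} {m}
      f : K ⊨ even-formula marks → Even m
      f (X , _ , (r , r-spine , r-root , r-marked) , (l , l-spine , l-last , l-marked) , no-both , no-neither) =
        to (marked m) last-marked
        where
        marked-at : ∀ (v : Node K) a → Sat {L} K (v ∷ᵥ []ᵥ) (X ∷ᵥ []ᵥ) (P v0 v0) →
          Sat {L} K (v ∷ᵥ []ᵥ) (X ∷ᵥ []ᵥ) (P a v0) → Sat K (v ∷ᵥ []ᵥ) (X ∷ᵥ []ᵥ) (marks v0) →
          ∃[ k ] Labelled m (k , 0) a × word (k , t) ∈ X
        marked-at v a spine lab mark with k , eq ← spine-position (v ∷ᵥ []ᵥ) X v0 spine =
          k , to (Sat-P {L} (v ∷ᵥ []ᵥ) (X ∷ᵥ []ᵥ) v0 (k , 0) a eq) lab , to (height m _ X v0 k eq) mark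
        root-marked : word (0 , t) ∈ X
        root-marked with _ , refl , p ← marked-at r v1 r-spine r-root r-marked = p
        last-marked : word (m , t) ∈ X
        last-marked with _ , refl , p ← marked-at l v2 l-spine l-last l-marked = p
        module Pair (k : ℕ) where
          ρ = node (suc k) ∷ᵥ node k ∷ᵥ []ᵥ
          θ = X ∷ᵥ []ᵥ
          spine₁ = from (Sat-P {L} {b} {m} ρ θ v1 (k , 0) v0 refl) refl
          spine₀ = from (Sat-P {L} {b} {m} ρ θ v0 (suc k , 0) v0 refl) refl
          child  = from (Sat-child {L} K ρ θ v1 v0) (0 , word-∷ʳ-spine k)
          mark₁  = height m ρ X v1 k refl
          mark₀  = height m ρ X v0 (suc k) refl
        alternates : ∀ k → word (suc k , t) ∈ X ⇔ (¬ word (k , t) ∈ X)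
        alternates k = mk⇔
          (λ p q → no-both (node k , node (suc k) , spine₁ , spine₀ , child , from mark₁ q , from mark₀ p))
          (λ ¬q → stable λ ¬p → no-neither
            (node k , node (suc k) , spine₁ , spine₀ , child , ¬q ∘ to mark₁ , ¬p ∘ to mark₀))
          where open Pair k
        marked : ∀ k → word (k , t) ∈ X ⇔ Even k
        marked zero    = mk⇔ (λ _ → tt) (λ _ → root-marked)
        marked (suc k) = ⇔-trans (alternates k) (¬-cong-⇔ (marked k))
      g : Even m → K ⊨ even-formula marks
      g even = evens , range ,
        (node 0 , spine 0 , label-at 0 v1 refl , mark 0 tt) ,
        (node m , spine m , label-at m v2 refl , mark m even) ,
        (λ (u , v , su , sv , child , mu , mv) → let k , pu , pv = pair u v su sv child in
          to pv mv (to pu mu)) ,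
        λ (u , v , su , sv , child , ¬mu , ¬mv) → let k , pu , pv = pair u v su sv child in
          ¬mv (from pv (¬mu ∘ from pu))
        where
        θ = evens ∷ᵥ []ᵥ
        label-at : ∀ k a → Labelled m (k , 0) a → Sat {L} K (node k ∷ᵥ []ᵥ) θ (P a v0)
        label-at k a = from (Sat-P {L} {b} {m} (node k ∷ᵥ []ᵥ) θ v0 (k , 0) a refl)
        spine : ∀ k → Sat {L} K (node k ∷ᵥ []ᵥ) θ (P v0 v0)
        spine k = label-at k v0 refl
        mark : ∀ k → Even k → Sat K (node k ∷ᵥ []ᵥ) θ (marks v0)
        mark k e = from (height m _ evens v0 k refl) (from (evens⇔ k) e)
        pair : ∀ (u v : Node K) → let ρ = v ∷ᵥ u ∷ᵥ []ᵥ in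
          Sat {L} K ρ θ (P v0 v1) → Sat {L} K ρ θ (P v0 v0) → Sat {L} K ρ θ (child-formula v1 v0) →
          ∃[ k ] (Sat K ρ θ (marks v1) ⇔ Even k) × (Sat K ρ θ (marks v0) ⇔ (¬ Even k))
        pair u v su sv child
          with k , equ ← spine-position (v ∷ᵥ u ∷ᵥ []ᵥ) evens v1 su
             | k′ , eqv ← spine-position (v ∷ᵥ u ∷ᵥ []ᵥ) evens v0 sv
             | n , eq ← to (Sat-child {L} K (v ∷ᵥ u ∷ᵥ []ᵥ) θ v1 v0) child
          with refl ← spine-child {k} {k′} (trans (sym eqv) (trans eq (cong (_∷ʳ n) equ))) =
          k , ⇔-trans (height m _ evens v1 k equ) (evens⇔ k) ,
              ⇔-trans (height m _ evens v0 (suc k) eqv) (evens⇔ (suc k))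

  even-or-next : ∀ n → ∃[ k ] n ≤ k × Even k
  even-or-next n with em {P = Even n}
  ... | yes even = n , ≤-refl , even
  ... | no odd   = suc n , n≤1+n n , odd

  even-spine-range : Range coWMSO (Comb false) even-spine
  even-spine-range = (λ (k , _ , eq) → (k , 0) , inj₁ refl , eq) , unbounded⇒infinite λ N →
    let k , N<k , even = even-or-next (suc N) in word (k , 0) , (k , even , refl) ,
      subst (N <_) (sym (length-word k 0)) (≤-trans N<k (m≤m+n k 0))

  even-spine⇔ : ∀ k → word (k , 0) ∈ even-spine ⇔ Even k
  even-spine⇔ k = mk⇔ f (λ even → k , even , refl)
    where
    f : word (k , 0) ∈ even-spine → Even k
    f (k′ , even , eq) with refl ← word-injective {k , 0} {k′ , 0} eq = even

  even-teeth-range : Range coWMTL (Comb true) even-teeth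
  even-teeth-range = ((λ (c , _ , eq) → c , inj₂ refl , eq) , from IsTree⇔RootedConvex
      ([] , ((0 , 0) , inj₁ refl , refl) , (λ _ → _ , refl) , convex)) ,
    unbounded⇒infinite λ N → word (suc N , 0) , ((suc N , 0) , inj₁ refl , refl) ,
      subst (N <_) (sym (length-word (suc N) 0)) (m≤m+n (suc N) 0)
    where
    convex : ∀ {u w} → w ∈ even-teeth → [] ⊑ u → u ⊑ w → u ∈ even-teeth
    convex {u} (c′ , h , refl) _ u⊑w with c , refl , c≼c′ ← ⊑-word u c′ u⊑w = c , down c c′ c≼c′ h , refl
      where
      down : ∀ c c′ → c ≼ c′ → proj₂ c′ ≡ 0 ⊎ (proj₂ c′ ≡ 1 × Even (proj₁ c′)) →
             proj₂ c ≡ 0 ⊎ (proj₂ c ≡ 1 × Even (proj₁ c))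
      down (k , y) (k′ , y′) (inj₁ (y≡0 , _))        h                   = inj₁ y≡0
      down (k , y) (k′ , y′) (inj₂ (refl , y≤0))     (inj₁ refl)         = inj₁ (n≤0⇒n≡0 y≤0)
      down (k , zero)  (k′ , y′) (inj₂ (refl , y≤1)) (inj₂ (refl , even)) = inj₁ refl
      down (k , suc y) (k′ , y′) (inj₂ (refl , s≤s y≤0)) (inj₂ (refl , even)) = inj₂ (cong suc (n≤0⇒n≡0 y≤0) , even)

  even-teeth⇔ : ∀ k → word (k , 1) ∈ even-teeth ⇔ Even k
  even-teeth⇔ k = mk⇔ f (λ even → (k , 1) , inj₂ (refl , even) , refl)
    where
    f : word (k , 1) ∈ even-teeth → Even k
    f (c , h , eq) with refl ← word-injective {k , 1} {c} eq with h
    ... | inj₂ (_ , even) = even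

  -- It suffices that the class contains the combs: those with teeth give the first separation, the
  -- bare spines the second.
  separation : (C : Class) → (∀ b m → C (comb b m)) → (coWMPL <[ C ] coWMTL) × (coWMTL <[ C ] coWMSO)
  separation C combs =
    (defines⇒≤ chain-formula chain-defines C ,
      even-inexpressible {coWMPL} (λ X → ⇔-refl) {C = C} (combs true) (even-formula {coWMTL} tooth-mark)
        (even-expressible {coWMTL} tooth-mark (tooth-marks {coWMTL}) even-teeth even-teeth-range even-teeth⇔)) ,
    (defines⇒≤ tree-formula tree-defines C ,
      even-inexpressible {coWMTL} spine-paths {C = C} (combs false) (even-formula {coWMSO} spine-mark)
        (even-expressible {coWMSO} spine-mark (spine-marks {coWMSO}) even-spine even-spine-range even-spine⇔))

theorem4 : (∀ {ℓ} → ExcludedMiddle ℓ) →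
    ((coWMPL <[ AllTrees ] coWMTL) × (coWMTL <[ AllTrees ] coWMSO)) ×
    ((coWMPL <[ FinitelyBranching ] coWMTL) × (coWMTL <[ FinitelyBranching ] coWMSO))
theorem4 em = separation AllTrees (λ _ _ → tt) , separation FinitelyBranching comb-finitelyBranching
  where open Classical em
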